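{- Let $\theta(n)$ denote the maximum interval colouring thickness of a graph on $n$ vertices, and $\theta'(m)$ the maximum interval colouring thickness of a graph with $m$ edges. Then $\theta(n)=\Omega\left(\frac{\log n}{\log\log n}\right)$, and consequently $\theta'(m)=\Omega\left(\frac{\log m}{\log\log m}\right)$.
   Context: All graphs are finite and simple. A graph $G$ is interval colourable if it admits an interval colouring: a proper edge-colouring $c\colon E(G)\to\mathbb{N}$ such that for every vertex $v$, the set $\{c(vw)\colon w\in N(v)\}$ consists of consecutive integers. The interval colouring thickness $\theta(G)$ of a graph $G$ is the minimum $k$ such that $E(G)$ can be partitioned into the edge sets of $k$ interval colourable subgraphs. $\theta(n)=\max\{\theta(G): |V(G)|=n\}$ and $\theta'(m)=\max\{\theta(G): |E(G)|=m\}$. -}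

module Defs where

open import Data.Nat using (ℕ; _≤_; _<ᵇ_; _+_; _*_)
open import Data.Nat.Logarithm using (⌊log₂_⌋)
open import Data.Bool using (Bool; true; false; _∧_; if_then_else_)
open import Data.Fin using (Fin; toℕ)
open import Data.List using (List; map; allFin)
open import Data.Nat.ListAction using (sum)
open import Data.Product using (Σ; _×_; ∃; ∃-syntax)
open import Relation.Binary.PropositionalEquality using (_≡_)

record Graph (n : ℕ) : Set where
  field
    adj   : Fin n → Fin n → Bool
    sym   : ∀ u v → adj u v ≡ adj v u
    irref : ∀ v → adj v v ≡ false
open Graph public

edgeCount : ∀ {n} → Graph n → ℕ
edgeCount {n} G =
  sum (map (λ u → sum (map (λ w → if adj G u w ∧ (toℕ u <ᵇ toℕ w) then 1 else 0)
                            (allFin n)))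
           (allFin n))

-- A spanning subgraph given by an edge predicate E (E v w: vw is an edge of the subgraph)
-- is interval colourable: there is a proper edge-colouring c (c v w = colour of edge vw)
-- whose colour set at each vertex consists of consecutive integers.
IntervalColourable : ∀ {n} → (Fin n → Fin n → Set) → Set
IntervalColourable {n} E =
  Σ (Fin n → Fin n → ℕ) λ c →
      (∀ v w → E v w → c v w ≡ c w v)
    × (∀ v w u → E v w → E v u → c v w ≡ c v u → w ≡ u)
    × (∀ v w u t → E v w → E v u → c v w ≤ t → t ≤ c v u →
         ∃[ x ] (E v x × c v x ≡ t))

ThicknessAtMost : ∀ {n} → Graph n → ℕ → Set
ThicknessAtMost {n} G k =
  Σ (Fin n → Fin n → Fin k) λ part →
      (∀ u v → adj G u v ≡ true → part u v ≡ part v u)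
    × (∀ (i : Fin k) → IntervalColourable (λ u v → adj G u v ≡ true × part u v ≡ i))

-- "θ(G) ≥ L / (a · LL)" in integer form: every partition size j satisfies L ≤ a·j·LL.
ThicknessLowerBound : ∀ {n} → Graph n → ℕ → ℕ → ℕ → Set
ThicknessLowerBound G a L LL = ∀ j → ThicknessAtMost G j → L ≤ a * j * LL

{-# OPTIONS --safe #-}

-- Points are the numbers z < W ^ r, and for every level i < r and slope s < R there is a centre
-- adjacent to all points sharing a "line" of level i and slope s; a line of level i has about W ^ i * q
-- points and contains whole blocks of all lower levels. In a decomposition into k < r parts, every point
-- sends, on each level, a 1/k share of its edges to a single part, and by pigeonhole the same part p on two
-- levels i < j; many points x share the same i, j, p. Counting pairs of such points on a common line
-- of level i (Cauchy–Schwarz) yields one x from which the lines of part p reach far more than W ^ i * q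
-- points, since lines of distinct slopes through x meet only near x. All these points lie on the same R
-- lines of level j, so one centre w of level j is joined within p to many of them. Walking
-- w – y – line – x inside p only meets degrees up to about W ^ i * q, so in an interval colouring the
-- colours of these edges at w are confined to a range too short to be distinct. All parameters
-- are polynomial in r, so the graph has r ^ O(r) vertices.

module Submission where

open import Defs
open import Data.Nat using (ℕ; _≤_; _≡ᵇ_)
open import Data.Nat.Logarithm using (⌊log₂_⌋)
open import Data.Product using (Σ; _×_; ∃; ∃-syntax)
open import Relation.Binary.PropositionalEquality using (_≡_)

open import Data.Bool using (Bool; true; false; _∧_; if_then_else_)
open import Data.Bool.Properties using (T-≡)
open import Data.Empty using (⊥)
open import Data.Fin using (Fin; zero; suc; toℕ; fromℕ<; combine; remQuot)
import Data.Fin as Fin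
import Data.Fin.Properties as Fin
open import Data.List using (map; allFin; tabulate)
open import Data.List.Properties using (map-tabulate)
open import Data.Nat using (_<ᵇ_; zero; suc; _+_; _*_; _∸_; _^_; _<_; z≤n; s≤s; z<s; NonZero; >-nonZero; >-nonZero⁻¹; _/_; _%_; _≟_; _≤?_; ⌊_/2⌋; ⌈_/2⌉)
open import Data.Nat.DivMod
import Data.Nat.ListAction as List
open import Data.Nat.Logarithm using (⌊log₂⌋-mono-≤; ⌊log₂[2^n]⌋≡n; ⌊log₂⌊n/2⌋⌋≡⌊log₂n⌋∸1)
open import Data.Nat.Properties hiding (_≟_; _≤?_)
open import Algebra.Properties.Semiring.Sum +-*-semiring using (sum; sum-cong-≗; ∑-comm; ∑-distrib-+; *-distribˡ-sum; *-distribʳ-sum)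
open import Data.Nat.Tactic.RingSolver using (solve-∀)
open import Data.Product using (_,_; proj₁; proj₂; ∃₂)
open import Data.Product.Function.NonDependent.Propositional using (_×-↔_)
open import Data.Sum using (_⊎_; inj₁; inj₂)
open import Data.Sum.Function.Propositional using (_⊎-↔_)
open import Data.Sum.Properties using (inj₁-injective)
open import Function using (_∘_; id)
open import Function.Bundles using (Equivalence; Inverse; _↔_)
open import Function.Properties.Inverse using (↔-refl; ↔-trans)
open import Relation.Binary.Definitions using (tri<; tri≈; tri>)
open import Relation.Binary.PropositionalEquality using (_≢_; refl; trans; cong; cong₂; subst; subst₂; module ≡-Reasoning) renaming (sym to ≡-sym)
open import Relation.Nullary using (¬_; Dec; yes; no; contradiction)
open import Relation.Nullary.Decidable using (_×-dec_; decidable-stable)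

-- Counting in finite sets

𝟙 : {A : Set} → Dec A → ℕ
𝟙 (yes _) = 1
𝟙 (no _)  = 0

𝟙-true : {A : Set} (A? : Dec A) → A → 𝟙 A? ≡ 1
𝟙-true (yes _) _ = refl
𝟙-true (no ¬a) a = contradiction a ¬a

𝟙≤ : {A : Set} (A? : Dec A) {m : ℕ} → (A → 1 ≤ m) → 𝟙 A? ≤ m
𝟙≤ (yes a) h = h a
𝟙≤ (no _)  _ = z≤n

𝟙-mono : {A B : Set} (A? : Dec A) (B? : Dec B) → (A → B) → 𝟙 A? ≤ 𝟙 B?
𝟙-mono A? B? h = 𝟙≤ A? (λ a → ≤-reflexive (≡-sym (𝟙-true B? (h a))))

𝟙-× : {A B : Set} (A? : Dec A) (B? : Dec B) → 𝟙 A? * 𝟙 B? ≡ 𝟙 (A? ×-dec B?)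
𝟙-× (yes _) (yes _) = refl
𝟙-× (yes _) (no _)  = refl
𝟙-× (no _)  (yes _) = refl
𝟙-× (no _)  (no _)  = refl

count : ∀ {n} {P : Fin n → Set} → (∀ x → Dec (P x)) → ℕ
count P? = sum (λ x → 𝟙 (P? x))

sum-mono : ∀ {n} {f g : Fin n → ℕ} → (∀ x → f x ≤ g x) → sum f ≤ sum g
sum-mono {zero}  h = z≤n
sum-mono {suc n} h = +-mono-≤ (h zero) (sum-mono (h ∘ suc))

sum-const : ∀ n c → sum {n} (λ _ → c) ≡ n * c
sum-const zero    c = refl
sum-const (suc n) c = cong (c +_) (sum-const n c)

term≤sum : ∀ {n} (f : Fin n → ℕ) x → f x ≤ sum f
term≤sum f zero    = m≤m+n _ _
term≤sum f (suc x) = ≤-trans (term≤sum (f ∘ suc) x) (m≤n+m _ (f zero))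

unique-count≤ : ∀ {n} {P : Fin n → Set} {C : Set} (P? : ∀ x → Dec (P x)) (C? : Dec C) →
  (∀ {x y} → P x → P y → x ≡ y) → (∀ {x} → P x → C) → count P? ≤ 𝟙 C?
unique-count≤ {zero}  P? C? uniq imp = z≤n
unique-count≤ {suc n} P? C? uniq imp with P? zero
... | no _   = unique-count≤ (P? ∘ suc) C? (λ px py → Fin.suc-injective (uniq px py)) imp
... | yes p₀ = begin
  1 + count (P? ∘ suc)  ≤⟨ +-monoʳ-≤ 1 (sum-mono {g = λ _ → 0} λ x → 𝟙≤ (P? (suc x)) λ p → contradiction (uniq p₀ p) λ ()) ⟩
  1 + sum {n} (λ _ → 0) ≡⟨ cong (1 +_) (trans (sum-const n 0) (*-zeroʳ n)) ⟩
  1                     ≡⟨ 𝟙-true C? (imp p₀) ⟨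
  𝟙 C?                  ∎
  where open ≤-Reasoning

count-injective≤ : ∀ {n M} {P : Fin n → Set} (P? : ∀ x → Dec (P x)) (g : Fin n → ℕ) →
  (∀ {x} → P x → g x < M) → (∀ {x y} → P x → P y → g x ≡ g y → x ≡ y) → count P? ≤ M
count-injective≤ {n} {M} P? g bound inj = begin
  count P?                                ≤⟨ sum-mono (λ x → 𝟙≤ (P? x) λ p → hit x p) ⟩
  sum (λ x → sum (λ t → 𝟙 (Q? x t)))      ≡⟨ ∑-comm (λ x t → 𝟙 (Q? x t)) ⟩
  sum (λ t → count (λ x → Q? x t))        ≤⟨ sum-mono {n = M} {g = λ _ → 1} (λ t → unique-count≤ (λ x → Q? x t) (yes refl) (λ (p , e) (p′ , e′) → inj p p′ (trans e (≡-sym e′))) (λ _ → refl {x = M})) ⟩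
  sum {M} (λ _ → 1)                       ≡⟨ trans (sum-const M 1) (*-identityʳ M) ⟩
  M                                       ∎
  where
  open ≤-Reasoning
  Q? : ∀ x (t : Fin M) → Dec (_ × g x ≡ toℕ t)
  Q? x t = P? x ×-dec (g x ≟ toℕ t)
  hit : ∀ x → _ → 1 ≤ sum (λ t → 𝟙 (Q? x t))
  hit x p = ≤-trans (≤-reflexive (≡-sym (𝟙-true (Q? x (fromℕ< (bound p))) (p , ≡-sym (Fin.toℕ-fromℕ< (bound p)))))) (term≤sum _ (fromℕ< (bound p)))

-- If the first term falls short of `c`, it can be discarded and the remaining terms still average
-- at least `c`.
average : ∀ {n} (f : Fin n → ℕ) c → 0 < n → n * c ≤ sum f → ∃[ x ] c ≤ f x
average {suc n} f c _ h with c ≤? f zero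
... | yes p = zero , p
... | no c≰f₀ with n
...   | zero  = contradiction (subst₂ _≤_ (+-identityʳ c) (+-identityʳ (f zero)) h) c≰f₀
...   | suc n′ = let (x , p) = average (f ∘ suc) c z<s (+-cancelˡ-≤ c _ _ (≤-trans h (+-monoˡ-≤ _ (<⇒≤ (≰⇒> c≰f₀))))) in suc x , p

popular-value : ∀ {m k} (f : Fin m → Fin k) → 0 < m → ∃[ p ] m ≤ k * count (λ x → f x Fin.≟ p)
popular-value {m@(suc _)} {k} f _ = average (λ p → k * count (λ x → f x Fin.≟ p)) m (≤-<-trans z≤n (Fin.toℕ<n (f zero))) (begin
  k * m                                             ≡⟨ cong (k *_) (trans (sum-const m 1) (*-identityʳ m)) ⟨
  k * sum {m} (λ _ → 1)                             ≤⟨ *-monoʳ-≤ k (sum-mono λ x → ≤-trans (≤-reflexive (≡-sym (𝟙-true (f x Fin.≟ f x) refl))) (term≤sum (λ p → 𝟙 (f x Fin.≟ p)) (f x))) ⟩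
  k * sum (λ x → sum (λ p → 𝟙 (f x Fin.≟ p)))       ≡⟨ cong (k *_) (∑-comm (λ x p → 𝟙 (f x Fin.≟ p))) ⟩
  k * sum (λ p → count (λ x → f x Fin.≟ p))         ≡⟨ *-distribˡ-sum k (λ p → count (λ x → f x Fin.≟ p)) ⟩
  sum (λ p → k * count (λ x → f x Fin.≟ p))         ∎)
  where open ≤-Reasoning

-- This is `(m - d)² ≥ 0`; the difference `e` avoids truncated subtraction.
2md≤d²+m² : ∀ m d → 2 * m * d ≤ d * d + m * m
2md≤d²+m² m d with ≤-total m d
... | inj₁ m≤d with e , refl ← m≤n⇒∃[o]m+o≡n m≤d = ≤-trans (m≤m+n _ (e * e)) (≤-reflexive (identity m e))
  where
  identity : ∀ m e → 2 * m * (m + e) + e * e ≡ (m + e) * (m + e) + m * m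
  identity = solve-∀
... | inj₂ d≤m with e , refl ← m≤n⇒∃[o]m+o≡n d≤m = ≤-trans (m≤m+n _ (e * e)) (≤-reflexive (identity d e))
  where
  identity : ∀ d e → 2 * (d + e) * d + e * e ≡ d * d + (d + e) * (d + e)
  identity = solve-∀

-- Cauchy–Schwarz over the fibres of key, linearised at the fibre weight m.
collisions : ∀ {n} (α : Fin n → ℕ) (key : Fin n → ℕ) T → (∀ x → key x < T) → ∀ m →
  2 * m * sum α ≤ sum (λ x → sum (λ y → α x * α y * 𝟙 (key x ≟ key y))) + T * (m * m)
collisions {n} α key T key<T m = begin
  2 * m * sum α                              ≤⟨ *-monoʳ-≤ (2 * m) weights ⟩
  2 * m * sum deg                            ≡⟨ *-distribˡ-sum (2 * m) deg ⟩
  sum (λ t → 2 * m * deg t)                  ≤⟨ sum-mono (λ t → 2md≤d²+m² m (deg t)) ⟩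
  sum (λ t → deg t * deg t + m * m)          ≡⟨ ∑-distrib-+ (λ t → deg t * deg t) (λ _ → m * m) ⟩
  sum (λ t → deg t * deg t) + sum {T} (λ _ → m * m) ≤⟨ +-mono-≤ squares (≤-reflexive (sum-const T (m * m))) ⟩
  sum (λ x → sum (λ y → α x * α y * 𝟙 (key x ≟ key y))) + T * (m * m) ∎
  where
  open ≤-Reasoning
  δ : Fin n → Fin T → ℕ
  δ x t = 𝟙 (key x ≟ toℕ t)
  deg : Fin T → ℕ
  deg t = sum (λ x → α x * δ x t)
  weights : sum α ≤ sum deg
  weights = begin
    sum α                                ≤⟨ sum-mono (λ x → ≤-trans (≤-reflexive (≡-sym (trans (cong (α x *_) (𝟙-true (key x ≟ _) (≡-sym (Fin.toℕ-fromℕ< (key<T x))))) (*-identityʳ (α x))))) (term≤sum (λ t → α x * δ x t) (fromℕ< (key<T x)))) ⟩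
    sum (λ x → sum (λ t → α x * δ x t))  ≡⟨ ∑-comm (λ x t → α x * δ x t) ⟩
    sum deg                              ∎
  square : ∀ t → deg t * deg t ≡ sum (λ x → sum (λ y → (α x * δ x t) * (α y * δ y t)))
  square t = trans (*-distribʳ-sum (deg t) (λ x → α x * δ x t)) (sum-cong-≗ λ x → *-distribˡ-sum (α x * δ x t) (λ y → α y * δ y t))
  regroup : ∀ a b c d → (a * b) * (c * d) ≡ a * c * (b * d)
  regroup = solve-∀
  fibre : ∀ x y → sum (λ t → (α x * δ x t) * (α y * δ y t)) ≤ α x * α y * 𝟙 (key x ≟ key y)
  fibre x y = begin
    sum (λ t → (α x * δ x t) * (α y * δ y t))  ≡⟨ sum-cong-≗ {T} (λ t → trans (regroup (α x) (δ x t) (α y) (δ y t)) (cong (α x * α y *_) (𝟙-× (key x ≟ toℕ t) (key y ≟ toℕ t)))) ⟩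
    sum (λ t → α x * α y * 𝟙 (both? t))         ≡⟨ *-distribˡ-sum (α x * α y) (λ t → 𝟙 (both? t)) ⟨
    -- At most one `t` equals both keys, and only if the keys agree.
    α x * α y * count both?                     ≤⟨ *-monoʳ-≤ (α x * α y) (unique-count≤ both? (key x ≟ key y) (λ (e , _) (e′ , _) → Fin.toℕ-injective (trans (≡-sym e) e′)) (λ (e , e′) → trans e (≡-sym e′))) ⟩
    α x * α y * 𝟙 (key x ≟ key y)               ∎
    where
    both? : ∀ (t : Fin T) → Dec (key x ≡ toℕ t × key y ≡ toℕ t)
    both? t = (key x ≟ toℕ t) ×-dec (key y ≟ toℕ t)
  squares : sum (λ t → deg t * deg t) ≤ sum (λ x → sum (λ y → α x * α y * 𝟙 (key x ≟ key y)))
  squares = begin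
    sum (λ t → deg t * deg t)  ≡⟨ sum-cong-≗ {T} square ⟩
    sum (λ t → sum (λ x → sum (λ y → (α x * δ x t) * (α y * δ y t))))  ≡⟨ ∑-comm (λ t x → sum (λ y → (α x * δ x t) * (α y * δ y t))) ⟩
    sum (λ x → sum (λ t → sum (λ y → (α x * δ x t) * (α y * δ y t))))  ≡⟨ sum-cong-≗ (λ x → ∑-comm (λ t y → (α x * δ x t) * (α y * δ y t))) ⟩
    sum (λ x → sum (λ y → sum (λ t → (α x * δ x t) * (α y * δ y t))))  ≤⟨ sum-mono (λ x → sum-mono (fibre x)) ⟩
    sum (λ x → sum (λ y → α x * α y * 𝟙 (key x ≟ key y)))  ∎

-- Interval colourings

-- The colouring notions are restated over an arbitrary vertex type, so that the graph can be
-- studied on a sum type and moved to `Fin n` only at the end.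
IntervalColouring : {V : Set} → (V → V → Set) → (V → V → ℕ) → Set
IntervalColouring E c =
    (∀ v w → E v w → c v w ≡ c w v)
  × (∀ v w u → E v w → E v u → c v w ≡ c v u → w ≡ u)
  × (∀ v w u t → E v w → E v u → c v w ≤ t → t ≤ c v u → ∃[ x ] (E v x × c v x ≡ t))

Decomposition : (V : Set) → (V → V → Bool) → ℕ → Set
Decomposition V adj k =
  Σ (V → V → Fin k) λ part →
      (∀ u v → adj u v ≡ true → part u v ≡ part v u)
    × (∀ i → ∃[ c ] IntervalColouring (λ u v → adj u v ≡ true × part u v ≡ i) c)

-- The hypotheses make the image of `f` an induced union of components. No edge at an image vertex
-- is lost, so its colours remain consecutive. This serves both for renaming vertices and for
-- undoing padding.
restrict : ∀ {V n k} {adjV : V → V → Bool} (G : Graph n) (f : V → Fin n) →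
  (∀ {v w} → f v ≡ f w → v ≡ w) →
  (∀ v w → adj G (f v) (f w) ≡ adjV v w) →
  (∀ v x → adj G (f v) x ≡ true → ∃[ w ] f w ≡ x) →
  ThicknessAtMost G k → Decomposition V adjV k
restrict {adjV = adjV} G f inj pres closed (part , psym , colour) =
  (λ v w → part (f v) (f w)) ,
  (λ v w e → psym (f v) (f w) (trans (pres v w) e)) ,
  λ i → let (c , csym , proper , interval) = colour i in
    (λ v w → c (f v) (f w)) ,
    (λ v w e → csym _ _ (up e)) ,
    (λ v w u e e′ eq → inj (proper _ _ _ (up e) (up e′) eq)) ,
    λ v w u t e e′ l l′ → pull {c = c} v (interval _ _ _ t (up e) (up e′) l l′)
  where
  up : ∀ {v w i} → adjV v w ≡ true × part (f v) (f w) ≡ i → adj G (f v) (f w) ≡ true × part (f v) (f w) ≡ i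
  up {v} {w} (a , p) = trans (pres v w) a , p
  pull : ∀ {i t} {c : Fin _ → Fin _ → ℕ} v → ∃[ x ] ((adj G (f v) x ≡ true × part (f v) x ≡ i) × c (f v) x ≡ t) →
    ∃[ w ] ((adjV v w ≡ true × part (f v) (f w) ≡ i) × c (f v) (f w) ≡ t)
  pull v (x , (a , p) , e) with w , refl ← closed v x a = w , (trans (≡-sym (pres v w)) a , p) , e

record Near (d a b : ℕ) : Set where
  constructor _,_
  field
    upper : a ≤ b + d
    lower : b ≤ a + d
open Near

near-trans : ∀ {d e a b c} → Near d a b → Near e b c → Near (d + e) a c
near-trans {d} {e} {a} {b} {c} (l₁ , l₂) (m₁ , m₂) =
  ≤-trans l₁ (≤-trans (+-monoˡ-≤ d m₁) (≤-reflexive (trans (+-assoc c e d) (cong (c +_) (+-comm e d))))) ,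
  ≤-trans m₂ (≤-trans (+-monoˡ-≤ e l₂) (≤-reflexive (+-assoc a d e)))

near-subst : ∀ {d a a′ b b′} → a ≡ a′ → b ≡ b′ → Near d a b → Near d a′ b′
near-subst refl refl h = h

-- The map `g` bounds the degree of `v` by `d`. Two colours at `v` further apart than `d` would
-- force `d + 1` consecutive colours there, hence two different edges with the same value of `g`.
colours-at-vertex-near : ∀ {V : Set} {E : V → V → Set} {c} → IntervalColouring E c →
  ∀ v d (g : ∀ x → E v x → Fin d) → (∀ {x y} ex ey → g x ex ≡ g y ey → x ≡ y) →
  ∀ {w u} → E v w → E v u → Near d (c v w) (c v u)
colours-at-vertex-near {V} {E} {c} (_ , _ , interval) v d g inj ew eu = half eu ew , half ew eu
  where
  half : ∀ {w u} → E v w → E v u → c v u ≤ c v w + d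
  half {w} {u} ew eu with c v u ≤? c v w + d
  ... | yes p = p
  ... | no ¬p = contradiction (Fin.pigeonhole (n<1+n d) (λ τ → g _ (proj₁ (proj₂ (witness τ))))) distinct
    where
    witness : (τ : Fin (suc d)) → ∃[ x ] (E v x × c v x ≡ c v w + toℕ τ)
    witness τ = interval v w u (c v w + toℕ τ) ew eu (m≤m+n _ _)
      (≤-trans (+-monoʳ-≤ (c v w) (≤-pred (Fin.toℕ<n τ))) (<⇒≤ (≰⇒> ¬p)))
    distinct : ¬ _
    distinct (τ , τ′ , τ<τ′ , eq) = <⇒≢ τ<τ′ (+-cancelˡ-≡ (c v w) _ _
      (trans (≡-sym (proj₂ (proj₂ (witness τ)))) (trans (cong (c v) (inj _ _ eq)) (proj₂ (proj₂ (witness τ′))))))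

-- The values lie in a window of `2d + 1` integers around `c₀`. Adding `d` before subtracting `c₀`
-- keeps the subtraction exact.
count-near≤ : ∀ {n d c₀} {P : Fin n → Set} (P? : ∀ x → Dec (P x)) (g : Fin n → ℕ) →
  (∀ {x} → P x → Near d (g x) c₀) → (∀ {x y} → P x → P y → g x ≡ g y → x ≡ y) → count P? ≤ suc (d + d)
count-near≤ {d = d} {c₀} P? g near inj = count-injective≤ P? (λ x → g x + d ∸ c₀)
  (λ p → s≤s (≤-trans (∸-monoˡ-≤ c₀ (+-monoˡ-≤ d (upper (near p)))) (≤-reflexive (trans (cong (_∸ c₀) (+-assoc c₀ d d)) (m+n∸m≡n c₀ (d + d))))))
  (λ p p′ e → inj p p′ (+-cancelʳ-≡ d _ _ (∸-cancelʳ-≡ (lower (near p)) (lower (near p′)) e)))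

-- The incidence structure

radix-< : ∀ {M h h′ o} → o < M → h < h′ → h * M + o < h′ * M
radix-< {M} {h} {h′} {o} o<M h<h′ = begin-strict
  h * M + o  <⟨ +-monoʳ-< (h * M) o<M ⟩
  h * M + M  ≡⟨ +-comm (h * M) M ⟩
  suc h * M  ≤⟨ *-monoˡ-≤ M h<h′ ⟩
  h′ * M     ∎
  where open ≤-Reasoning

radix-injective : ∀ {M h h′ o o′} → o < M → o′ < M → h * M + o ≡ h′ * M + o′ → h ≡ h′ × o ≡ o′
radix-injective {M} {h} {h′} o<M o′<M eq with <-cmp h h′
... | tri≈ _ refl _ = refl , +-cancelˡ-≡ (h * M) _ _ eq
... | tri< h<h′ _ _ = contradiction eq (<⇒≢ (<-≤-trans (radix-< o<M h<h′) (m≤m+n _ _)))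
... | tri> _ _ h′<h = contradiction (≡-sym eq) (<⇒≢ (<-≤-trans (radix-< o′<M h′<h) (m≤m+n _ _)))

-- Eliminating the intercepts leaves `(s′ - s) * a ≡ (s′ - s) * a′`. To stay within the naturals,
-- the first equation is reversed and added to the second.
lines-meet-once-< : ∀ {s s′ a a′ b b′} → s < s′ →
  b + s * a ≡ b′ + s * a′ → b + s′ * a ≡ b′ + s′ * a′ → a ≡ a′
lines-meet-once-< {s} {a = a} {a′} {b} {b′} s<s′ e e′ with d , refl ← m≤n⇒∃[o]m+o≡n s<s′ =
  *-cancelˡ-≡ a a′ (suc d) (+-cancelˡ-≡ (b + b′ + s * a + s * a′) _ _
    (trans (≡-sym (expand s d a a′ b b′)) (trans (cong₂ _+_ (≡-sym e) e′) (expand′ s d a a′ b b′))))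
  where
  expand : ∀ s d a a′ b b′ → (b′ + s * a′) + (b + (suc s + d) * a) ≡ (b + b′ + s * a + s * a′) + suc d * a
  expand = solve-∀
  expand′ : ∀ s d a a′ b b′ → (b + s * a) + (b′ + (suc s + d) * a′) ≡ (b + b′ + s * a + s * a′) + suc d * a′
  expand′ = solve-∀

lines-meet-once : ∀ {s s′ a a′ b b′} → s ≢ s′ →
  b + s * a ≡ b′ + s * a′ → b + s′ * a ≡ b′ + s′ * a′ → a ≡ a′
lines-meet-once {s} {s′} {a} {a′} {b} {b′} s≢s′ e e′ with <-cmp s s′
... | tri≈ _ s≡s′ _ = contradiction s≡s′ s≢s′
... | tri< s<s′ _ _ = lines-meet-once-< {a = a} {a′} {b} {b′} s<s′ e e′
... | tri> _ _ s′<s = lines-meet-once-< {a = a} {a′} {b} {b′} s′<s e′ e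

divmod-injective : ∀ {m n} d .{{_ : NonZero d}} → m % d ≡ n % d → m / d ≡ n / d → m ≡ n
divmod-injective {m} {n} d e e′ =
  trans (m≡m%n+[m/n]*n m d) (trans (cong₂ (λ r k → r + k * d) e e′) (≡-sym (m≡m%n+[m/n]*n n d)))

module Incidence (q R : ℕ) .{{_ : NonZero q}} .{{_ : NonZero R}} where

  N W : ℕ
  N = R * q
  W = N * q

  instance
    N≢0 : NonZero N
    N≢0 = m*n≢0 R q
    W≢0 : NonZero W
    W≢0 = m*n≢0 N q

  W^≢0 : ∀ i → NonZero (W ^ i)
  W^≢0 i = m^n≢0 W i

  abscissa ordinate : ℕ → ℕ
  abscissa u = u % W % q
  ordinate u = u % W / q

  -- The last base-W digit of u encodes a point (a , b) of the q × N grid; line s u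
  -- numbers the line of slope - s through it, the leading digits of u choosing a copy of the grid.
  line : ℕ → ℕ → ℕ
  line s u = u / W * (N + N) + (ordinate u + s * abscissa u)

  -- Both summands are below `N = R * q`. Allowing `N + N` intercepts means that lines never wrap
  -- around, so integer arithmetic replaces a finite field.
  intercept< : ∀ {s} u → s < R → ordinate u + s * abscissa u < N + N
  intercept< u s<R = +-mono-< (m<n*o⇒m/o<n (m%n<n u W)) (*-mono-< s<R (m%n<n (u % W) q))

  line-injective : ∀ {s u v} → s < R → line s u ≡ line s v →
    u / W ≡ v / W × ordinate u + s * abscissa u ≡ ordinate v + s * abscissa v
  line-injective {u = u} {v} s<R e = radix-injective (intercept< u s<R) (intercept< v s<R) e

  on-line-injective : ∀ {s u v} → s < R → line s u ≡ line s v → abscissa u ≡ abscissa v → u ≡ v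
  on-line-injective {s} {u} {v} s<R e ea =
    let (eh , ei) = line-injective s<R e
        eb = +-cancelʳ-≡ (s * abscissa v) (ordinate u) (ordinate v) (subst (λ a → ordinate u + s * a ≡ ordinate v + s * abscissa v) ea ei)
    in divmod-injective W (divmod-injective q ea eb) eh

  -- Distinct slopes force equal abscissae, and a point of a line is determined by its abscissa.
  two-lines-injective : ∀ {s s′ u v} → s < R → s′ < R → s ≢ s′ →
    line s u ≡ line s v → line s′ u ≡ line s′ v → u ≡ v
  two-lines-injective {u = u} {v} s<R s′<R s≢s′ e e′ = on-line-injective s<R e
    (lines-meet-once {a = abscissa u} {abscissa v} {ordinate u} {ordinate v} s≢s′
      (proj₂ (line-injective s<R e)) (proj₂ (line-injective s′<R e′)))

  -- Drops the `i` lowest base-`W` digits: the last digit left is the grid point used at level `i`,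
  -- and numbers with equal shift form a block of `W ^ i` consecutive numbers.
  shift : ℕ → ℕ → ℕ
  shift i z = _/_ z (W ^ i) {{W^≢0 i}}

  shift-suc : ∀ i z → shift (suc i) z ≡ shift i z / W
  shift-suc i z = trans (/-congʳ {m = z} {{W^≢0 (suc i)}} {{m*n≢0 (W ^ i) W {{W^≢0 i}}}} (*-comm W (W ^ i))) (≡-sym (m/n/o≡m/[n*o] z (W ^ i) W {{W^≢0 i}} {{W≢0}} {{m*n≢0 (W ^ i) W {{W^≢0 i}}}}))

  shift-≤ : ∀ {i j x y} → i ≤ j → shift i x ≡ shift i y → shift j x ≡ shift j y
  shift-≤ {i} {j} {x} {y} i≤j e with d , refl ← m≤n⇒∃[o]m+o≡n i≤j = go d
    where
    go : ∀ d → shift (i + d) x ≡ shift (i + d) y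
    go zero    = subst (λ j → shift j x ≡ shift j y) (≡-sym (+-identityʳ i)) e
    go (suc d) = subst (λ j → shift j x ≡ shift j y) (≡-sym (+-suc i d))
      (trans (shift-suc (i + d) x) (trans (cong (_/ W) (go d)) (≡-sym (shift-suc (i + d) y))))

  shift< : ∀ i e {z} → z < W ^ (e + i) → shift i z < W ^ e
  shift< i e {z} z< = m<n*o⇒m/o<n {{W^≢0 i}} (subst (z <_) (^-distribˡ-+-* W e i) z<)

  line< : ∀ {s} i e {z} → s < R → z < W ^ (e + suc i) → line s (shift i z) < W ^ e * (N + N)
  line< i e {z} s<R z< = radix-< (intercept< (shift i z) s<R) (subst (_< W ^ e) (shift-suc i z) (shift< (suc i) e z<))

  -- A line number records its copy of the grid, and one copy at level `i` is one block of level
  -- `i + 1`.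
  same-line⇒same-shift : ∀ {s} i {x y} → s < R → line s (shift i x) ≡ line s (shift i y) →
    shift (suc i) x ≡ shift (suc i) y
  same-line⇒same-shift i {x} {y} s<R e = trans (shift-suc i x) (trans (proj₁ (line-injective s<R e)) (≡-sym (shift-suc i y)))

-- Incidences are counted first by point, then by slope. This is used on level `i` to produce many
-- incidences in one part, and on level `j` to find a centre with many neighbours.
double-count : ∀ {n R} {Z : Fin n → Set} {F : Fin R → Fin n → Set}
  (Z? : ∀ x → Dec (Z x)) (F? : ∀ s x → Dec (F s x)) k →
  (∀ x → Z x → R ≤ k * count (λ s → F? s x)) →
  R * count Z? ≤ k * sum (λ s → count (λ x → Z? x ×-dec F? s x))
double-count {R = R} Z? F? k large = begin
  R * count Z?                                        ≡⟨ *-distribˡ-sum R (λ x → 𝟙 (Z? x)) ⟩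
  sum (λ x → R * 𝟙 (Z? x))                            ≤⟨ sum-mono pointwise ⟩
  sum (λ x → k * count (λ s → Z? x ×-dec F? s x))     ≡⟨ *-distribˡ-sum k (λ x → count (λ s → Z? x ×-dec F? s x)) ⟨
  k * sum (λ x → count (λ s → Z? x ×-dec F? s x))     ≡⟨ cong (k *_) (∑-comm (λ x s → 𝟙 (Z? x ×-dec F? s x))) ⟩
  k * sum (λ s → count (λ x → Z? x ×-dec F? s x))     ∎
  where
  open ≤-Reasoning
  pointwise : ∀ x → R * 𝟙 (Z? x) ≤ k * count (λ s → Z? x ×-dec F? s x)
  pointwise x with Z? x
  ... | no _  = ≤-trans (≤-reflexive (*-zeroʳ R)) z≤n
  ... | yes z = begin
    R * 1                                    ≡⟨ *-identityʳ R ⟩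
    R                                        ≤⟨ large x z ⟩
    k * count (λ s → F? s x)                 ≤⟨ *-monoʳ-≤ k (sum-mono (λ s → 𝟙-mono (F? s x) (yes z ×-dec F? s x) (z ,_))) ⟩
    k * count (λ s → yes z ×-dec F? s x)     ∎

-- The graph of points and line centres

module Construction (q R r : ℕ) .{{_ : NonZero q}} .{{_ : NonZero R}} where
  open Incidence q R

  P : ℕ
  P = W ^ r

  lines : Fin r → ℕ
  lines i = W ^ (r ∸ suc (toℕ i)) * (N + N)

  label : Fin r → Fin R → Fin P → ℕ
  label i s x = line (toℕ s) (shift (toℕ i) (toℕ x))

  label<lines : ∀ i s x → label i s x < lines i
  label<lines i s x = line< (toℕ i) (r ∸ suc (toℕ i)) (Fin.toℕ<n s)
    (subst (λ e → toℕ x < W ^ e) (≡-sym (m∸n+n≡m (Fin.toℕ<n i))) (Fin.toℕ<n x))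

  -- A line of level `i` has at most `W ^ i * q` points; the factor two comes from the `N + N`
  -- intercepts in each grid.
  lines*size : ∀ i → lines i * (W ^ toℕ i * q) ≡ P + P
  lines*size i = begin
    W ^ e * (N + N) * (W ^ toℕ i * q)        ≡⟨ regroup (W ^ e) N (W ^ toℕ i) q ⟩
    2 * (W ^ e * W ^ suc (toℕ i))            ≡⟨ cong (2 *_) (^-distribˡ-+-* W e (suc (toℕ i))) ⟨
    2 * W ^ (e + suc (toℕ i))                ≡⟨ cong (λ e → 2 * W ^ e) (m∸n+n≡m (Fin.toℕ<n i)) ⟩
    2 * P                                    ≡⟨ cong (P +_) (+-identityʳ P) ⟩
    P + P                                    ∎
    where
    open ≡-Reasoning
    e = r ∸ suc (toℕ i)
    regroup : ∀ a N b q → a * (N + N) * (b * q) ≡ 2 * (a * (N * q * b))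
    regroup = solve-∀

  abstract
    label<P+P : ∀ i s x → label i s x < P + P
    label<P+P i s x = <-≤-trans (label<lines i s x)
      (subst (lines i ≤_) (lines*size i) (m≤m*n (lines i) (W ^ toℕ i * q) {{m*n≢0 (W ^ toℕ i) q {{W^≢0 (toℕ i)}}}}))

  -- All levels and slopes share the index range `P + P`, which covers the line numbers of every
  -- level; centres with no line are isolated vertices.
  Vertex : Set
  Vertex = Fin P ⊎ (Fin r × Fin R × Fin (P + P))

  adjacent : Vertex → Vertex → Bool
  adjacent (inj₁ _)           (inj₁ _)           = false
  adjacent (inj₁ x)           (inj₂ (i , s , t)) = label i s x ≡ᵇ toℕ t
  adjacent (inj₂ (i , s , t)) (inj₁ x)           = label i s x ≡ᵇ toℕ t
  adjacent (inj₂ _)           (inj₂ _)           = false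

  adjacent-sym : ∀ u v → adjacent u v ≡ adjacent v u
  adjacent-sym (inj₁ _) (inj₁ _) = refl
  adjacent-sym (inj₁ _) (inj₂ _) = refl
  adjacent-sym (inj₂ _) (inj₁ _) = refl
  adjacent-sym (inj₂ _) (inj₂ _) = refl

  adjacent-irrefl : ∀ v → adjacent v v ≡ false
  adjacent-irrefl (inj₁ _) = refl
  adjacent-irrefl (inj₂ _) = refl

  on-line : ∀ {i s t x} → adjacent (inj₁ x) (inj₂ (i , s , t)) ≡ true → label i s x ≡ toℕ t
  on-line e = ≡ᵇ⇒≡ _ _ (Equivalence.from T-≡ e)

  centre : Fin r → Fin R → Fin P → Vertex
  centre i s x = inj₂ (i , s , fromℕ< (label<P+P i s x))

  centre-adjacent : ∀ i s x → adjacent (inj₁ x) (centre i s x) ≡ true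
  centre-adjacent i s x = Equivalence.to T-≡ (≡⇒≡ᵇ _ _ (≡-sym (Fin.toℕ-fromℕ< (label<P+P i s x))))

  centre-cong : ∀ {i s x y} → label i s x ≡ label i s y → centre i s x ≡ centre i s y
  centre-cong {i} {s} {x} {y} e = cong (λ t → inj₂ (i , s , t)) (Fin.toℕ-injective
    (trans (Fin.toℕ-fromℕ< (label<P+P i s x)) (trans e (≡-sym (Fin.toℕ-fromℕ< (label<P+P i s y))))))

  -- A common line on level `i` puts both points into one block of level `i + 1`, and such a block
  -- is never separated on a higher level.
  label-later : ∀ {i j s s′ x y} → toℕ i < toℕ j → label i s x ≡ label i s y → label j s′ x ≡ label j s′ y
  label-later {i} {s = s} {s′} i<j e = cong (line (toℕ s′)) (shift-≤ i<j (same-line⇒same-shift (toℕ i) (Fin.toℕ<n s) e))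

  -- Colours inside one part of a decomposition

  module Parts {k} (dec : Decomposition Vertex adjacent k) where

    part : Vertex → Vertex → Fin k
    part = proj₁ dec

    part-sym : ∀ u v → adjacent u v ≡ true → part u v ≡ part v u
    part-sym = proj₁ (proj₂ dec)

    Edge : Fin k → Vertex → Vertex → Set
    Edge p u v = adjacent u v ≡ true × part u v ≡ p

    edge-sym : ∀ {p u v} → Edge p u v → Edge p v u
    edge-sym {u = u} {v} (a , e) = trans (adjacent-sym v u) a , trans (≡-sym (part-sym u v a)) e

    f : Fin r → Fin R → Fin P → Fin k
    f i s x = part (inj₁ x) (centre i s x)

    edge : ∀ {p i s x} → f i s x ≡ p → Edge p (inj₁ x) (centre i s x)
    edge {i = i} {s} {x} e = centre-adjacent i s x , e

    edge′ : ∀ {p i s x y} → label i s x ≡ label i s y → f i s y ≡ p → Edge p (inj₁ y) (centre i s x)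
    edge′ {p} {y = y} l e = subst (Edge p (inj₁ y)) (≡-sym (centre-cong l)) (edge e)

    module Colour (p : Fin k) where

      c : Vertex → Vertex → ℕ
      c = proj₁ (proj₂ (proj₂ dec) p)

      colouring : IntervalColouring (Edge p) c
      colouring = proj₂ (proj₂ (proj₂ dec) p)

      c-sym : ∀ u v → Edge p u v → c u v ≡ c v u
      c-sym = proj₁ colouring

      -- A point has one centre for each level and slope, so its degree is at most `r * R`.
      near-point : ∀ {x u v} → Edge p (inj₁ x) u → Edge p (inj₁ x) v → Near (r * R) (c (inj₁ x) u) (c (inj₁ x) v)
      near-point {x} = colours-at-vertex-near colouring (inj₁ x) (r * R) slot slot-injective
        where
        slot : ∀ v → Edge p (inj₁ x) v → Fin (r * R)
        slot (inj₁ _)           (() , _)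
        slot (inj₂ (i , s , _)) _ = combine i s
        slot-injective : ∀ {u v} eu ev → slot u eu ≡ slot v ev → u ≡ v
        slot-injective {inj₁ _} (() , _)
        slot-injective {inj₂ _} {inj₁ _} _ (() , _)
        slot-injective {inj₂ (i , s , t)} {inj₂ (i′ , s′ , t′)} (a , _) (a′ , _) e
          with refl , refl ← Fin.combine-injective i s i′ s′ e =
          cong (λ t → inj₂ (i , s , t)) (Fin.toℕ-injective (trans (≡-sym (on-line {i} {s} {t} {x} a)) (on-line {i} {s} {t′} {x} a′)))

      -- On a fixed line the abscissa determines the block of level `i`, and the `i` low digits
      -- determine the point inside it, so the degree is at most `W ^ i * q`.
      near-centre : ∀ {i s t u v} → Edge p (inj₂ (i , s , t)) u → Edge p (inj₂ (i , s , t)) v →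
        Near (W ^ toℕ i * q) (c (inj₂ (i , s , t)) u) (c (inj₂ (i , s , t)) v)
      near-centre {i} {s} {t} = colours-at-vertex-near colouring (inj₂ (i , s , t)) (W ^ toℕ i * q) slot slot-injective
        where
        low : ∀ (y : Fin P) → Fin (W ^ toℕ i)
        low y = fromℕ< (m%n<n (toℕ y) (W ^ toℕ i) {{W^≢0 (toℕ i)}})
        place : ∀ (y : Fin P) → Fin q
        place y = fromℕ< (m%n<n (shift (toℕ i) (toℕ y) % W) q)
        slot : ∀ v → Edge p (inj₂ (i , s , t)) v → Fin (W ^ toℕ i * q)
        slot (inj₂ _) (() , _)
        slot (inj₁ y) _ = combine (low y) (place y)
        slot-injective : ∀ {u v} eu ev → slot u eu ≡ slot v ev → u ≡ v
        slot-injective {inj₂ _} (() , _)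
        slot-injective {inj₁ _} {inj₂ _} _ (() , _)
        slot-injective {inj₁ y} {inj₁ y′} (a , _) (a′ , _) e =
          let (el , ep) = Fin.combine-injective (low y) (place y) (low y′) (place y′) e
          in cong inj₁ (Fin.toℕ-injective (divmod-injective (W ^ toℕ i) {{W^≢0 (toℕ i)}} (Fin.fromℕ<-injective _ _ _ _ el)
            (on-line-injective (Fin.toℕ<n s) (trans (on-line {i} {s} {t} {y} a) (≡-sym (on-line {i} {s} {t} {y′} a′))) (Fin.fromℕ<-injective _ _ _ _ ep))))

    Linked : Fin r → Fin k → Fin P → Fin P → Set
    Linked i p x y = ∃[ s ] (f i s x ≡ p × f i s y ≡ p × label i s x ≡ label i s y)

    -- A point y linked to x and adjacent to w within part p gives the walk w – y – line – x.
    radius : Fin r → ℕ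
    radius i = r * R + (W ^ toℕ i * q + r * R)

    -- Each colour `c w y` is near the colour of one fixed edge at `x`, whatever line joins `y` to
    -- `x`; properness at `w` makes these colours distinct.
    linked-neighbours≤ : ∀ i p x w {Z : Fin P → Set} (Z? : ∀ y → Dec (Z y)) →
      (∀ {y} → Z y → Edge p w (inj₁ y) × Linked i p x y) → count Z? ≤ suc (radius i + radius i)
    linked-neighbours≤ i p x w {Z} Z? h with Fin.any? Z?
    ... | no none = count-injective≤ Z? (λ _ → 0) (λ z → contradiction (_ , z) none) (λ z → contradiction (_ , z) none)
    ... | yes (y₀ , z₀) =
      count-near≤ {c₀ = c (inj₁ x) ℓ₀} Z? (λ y → c w (inj₁ y)) (λ {y} z → near y (proj₁ (h z)) (proj₂ (h z))) inj
      where
      open Colour p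
      -- The reference edge at `x` is taken from an arbitrary element of `Z`, which is why the empty
      -- case is split off.
      ℓ₀ : Vertex
      ℓ₀ = centre i (proj₁ (proj₂ (h z₀))) x
      xℓ₀ : Edge p (inj₁ x) ℓ₀
      xℓ₀ = edge (proj₁ (proj₂ (proj₂ (h z₀))))
      near : ∀ y → Edge p w (inj₁ y) → Linked i p x y → Near (radius i) (c w (inj₁ y)) (c (inj₁ x) ℓ₀)
      near y wy (s , ex , ey , l) =
        -- The colour is carried along the walk, with one comparison each at `y`, at `ℓ` and at `x`.
        near-trans
          (near-subst (c-sym (inj₁ y) w yw) (c-sym (inj₁ y) ℓ yℓ) (near-point {y} {w} {ℓ} yw yℓ))
          (near-trans
            (near-subst refl (≡-sym (c-sym (inj₁ x) ℓ xℓ)) (near-centre {u = inj₁ y} {inj₁ x} (edge-sym {u = inj₁ y} {ℓ} yℓ) (edge-sym {u = inj₁ x} {ℓ} xℓ)))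
            (near-point {x} {ℓ} {ℓ₀} xℓ xℓ₀))
        where
        ℓ : Vertex
        ℓ = centre i s x
        yw : Edge p (inj₁ y) w
        yw = edge-sym {u = w} {inj₁ y} wy
        yℓ : Edge p (inj₁ y) ℓ
        yℓ = edge′ l ey
        xℓ : Edge p (inj₁ x) ℓ
        xℓ = edge ex
      inj : ∀ {y y′} → Z y → Z y′ → c w (inj₁ y) ≡ c w (inj₁ y′) → y ≡ y′
      inj {y} {y′} z z′ e = inj₁-injective (proj₁ (proj₂ colouring) w (inj₁ y) (inj₁ y′) (proj₁ (h z)) (proj₁ (h z′)) e)

-- Counting in a decomposition into few parts

-- Bounds the total pigeonhole loss: `r * r * k` for fixing two levels and a part, and one more `k`
-- for the share of slopes in that part.
fourth : ℕ → ℕ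
fourth B = B * B * (B * B)

incidences-dense : ∀ {P R r B k S total} → r ≤ B → k ≤ B →
  P ≤ r * (r * k) * S → R * S ≤ k * total → P * R ≤ fourth B * total
incidences-dense {P} {R} {r} {B} {k} {S} {total} r≤B k≤B dense large = begin
  P * R                          ≤⟨ *-monoˡ-≤ R dense ⟩
  r * (r * k) * S * R            ≡⟨ trans (*-assoc (r * (r * k)) S R) (cong (r * (r * k) *_) (*-comm S R)) ⟩
  r * (r * k) * (R * S)          ≤⟨ *-monoʳ-≤ (r * (r * k)) large ⟩
  r * (r * k) * (k * total)      ≤⟨ *-mono-≤ (*-mono-≤ r≤B (*-mono-≤ r≤B k≤B)) (*-monoˡ-≤ total k≤B) ⟩
  B * (B * B) * (B * total)      ≡⟨ regroup B total ⟩
  fourth B * total               ∎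
  where
  open ≤-Reasoning
  regroup : ∀ B t → B * (B * B) * (B * t) ≡ B * B * (B * B) * t
  regroup = solve-∀

-- With `m = P / (L * Q)`, a lower bound for the average number of incidences per line, the error
-- term of the Cauchy-Schwarz step consumes exactly half of the main term.
walks-dense : ∀ {P R Q m L total walks} → P * R ≤ Q * total → L * (Q * m) ≡ P →
  2 * m * total ≤ walks + R * (L * (m * m)) → P * (m * R) ≤ Q * walks
walks-dense {P} {R} {Q} {m} {L} {total} {walks} dense lines cs = +-cancelʳ-≤ (P * (m * R)) _ _ (begin
  P * (m * R) + P * (m * R)              ≡⟨ double P m R ⟩
  2 * m * (P * R)                        ≤⟨ *-monoʳ-≤ (2 * m) dense ⟩
  2 * m * (Q * total)                    ≡⟨ swap (2 * m) Q total ⟩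
  Q * (2 * m * total)                    ≤⟨ *-monoʳ-≤ Q cs ⟩
  Q * (walks + R * (L * (m * m)))        ≡⟨ expand Q walks R L m ⟩
  Q * walks + L * (Q * m) * (m * R)      ≡⟨ cong (λ P → Q * walks + P * (m * R)) lines ⟩
  Q * walks + P * (m * R)                ∎)
  where
  open ≤-Reasoning
  double : ∀ P m R → P * (m * R) + P * (m * R) ≡ 2 * m * (P * R)
  double = solve-∀
  swap : ∀ a b c → a * (b * c) ≡ b * (a * c)
  swap = solve-∀
  expand : ∀ Q w R L m → Q * (w + R * (L * (m * m))) ≡ Q * w + L * (Q * m) * (m * R)
  expand = solve-∀

-- Each radius is at most `4 * D * B * R`, so `n` is at most `9 * D * B * R` and `Y + D * R` at most
-- `10 * B * B * D * R`, whereas `h` demands `16 * B * B * D * R`.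
parameters-clash : ∀ {B R D q r k Y n} → 0 < B → 0 < R → 0 < D → r ≤ B → k ≤ B → q ≡ 2 * (B * R) →
  16 * (B * B * fourth B) * D * R ≤ fourth B * (Y + D * R) → Y ≤ k * n →
  n ≤ suc ((r * R + (D * q + r * R)) + (r * R + (D * q + r * R))) → ⊥
parameters-clash {B@(suc _)} {R@(suc _)} {D@(suc _)} {q} {r} {k} {Y} {n} _ _ _ r≤B k≤B refl h Y≤ n≤ =
  <⇒≱ (*-monoʳ-< (fourth B * (B * B * (D * R))) (≤ᵇ⇒≤ 11 16 _)) (begin
    fourth B * (B * B * (D * R)) * 16                            ≡⟨ regroup (fourth B) B D R ⟩
    16 * (B * B * fourth B) * D * R                              ≤⟨ h ⟩
    fourth B * (Y + D * R)                                       ≤⟨ *-monoʳ-≤ (fourth B) (+-mono-≤ Y≤9 (m≤n*m (D * R) (B * B))) ⟩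
    fourth B * (B * (9 * (D * (B * R))) + B * B * (D * R))       ≡⟨ collect (fourth B) B D R ⟩
    fourth B * (B * B * (D * R)) * 10                            ∎)
  where
  open ≤-Reasoning
  regroup : ∀ Q B D R → Q * (B * B * (D * R)) * 16 ≡ 16 * (B * B * Q) * D * R
  regroup = solve-∀
  collect : ∀ Q B D R → Q * (B * (9 * (D * (B * R))) + B * B * (D * R)) ≡ Q * (B * B * (D * R)) * 10
  collect = solve-∀
  gather : ∀ D B R → D * (B * R) + ((D * (B * R) + (D * (2 * (B * R)) + D * (B * R))) + (D * (B * R) + (D * (2 * (B * R)) + D * (B * R)))) ≡ 9 * (D * (B * R))
  gather = solve-∀
  rR≤ : r * R ≤ D * (B * R)
  rR≤ = ≤-trans (*-monoˡ-≤ R r≤B) (m≤n*m (B * R) D)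
  rad≤ : r * R + (D * q + r * R) ≤ D * (B * R) + (D * (2 * (B * R)) + D * (B * R))
  rad≤ = +-mono-≤ rR≤ (+-monoʳ-≤ (D * q) rR≤)
  Y≤9 : Y ≤ B * (9 * (D * (B * R)))
  Y≤9 = ≤-trans Y≤ (*-mono-≤ k≤B (≤-trans n≤ (≤-trans (+-mono-≤ {1} (s≤s z≤n) (+-mono-≤ rad≤ rad≤)) (≤-reflexive (gather D B R)))))

module Refutation (q R r B k : ℕ) .{{_ : NonZero q}} .{{_ : NonZero R}}
  (k<r : k < r) (r≤B : r ≤ B) (q≡ : q ≡ 2 * (B * R)) (BR≡ : B * R ≡ 16 * (B * B * fourth B) * fourth B)
  (dec : Decomposition (Construction.Vertex q R r) (Construction.adjacent q R r) k) where
  open Incidence q R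
  open Construction q R r
  open Parts dec

  k≤B : k ≤ B
  k≤B = ≤-trans (<⇒≤ k<r) r≤B

  0<R : 0 < R
  0<R = >-nonZero⁻¹ R

  0<W^ : ∀ i → 0 < W ^ i
  0<W^ i = >-nonZero⁻¹ (W ^ i) {{W^≢0 i}}

  Popular : Fin r → Fin k → Fin P → Set
  Popular i p x = R ≤ k * count (λ s → f i s x Fin.≟ p)

  majority : ∀ i x → ∃[ p ] Popular i p x
  majority i x = popular-value (λ s → f i s x) 0<R

  twins : ∀ x → ∃₂ λ i j → i Fin.< j × proj₁ (majority i x) ≡ proj₁ (majority j x)
  twins x = Fin.pigeonhole k<r (λ i → proj₁ (majority i x))

  -- The triple of two levels and a common part is packed into one finite type, so that a single
  -- pigeonhole selects all three.
  type : Fin P → Fin (r * (r * k))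
  type x = let (i , j , _) = twins x in combine i (combine j (proj₁ (majority i x)))

  type-spec : ∀ {x} i j p → type x ≡ combine i (combine j p) → toℕ i < toℕ j × Popular i p x × Popular j p x
  type-spec {x} i j p e = conclude (twins x) refl
    where
    conclude : ∀ t → twins x ≡ t → toℕ i < toℕ j × Popular i p x × Popular j p x
    conclude (i′ , j′ , i′<j′ , same) et
      with ei , ejp ← Fin.combine-injective i′ (combine j′ (proj₁ (majority i′ x))) i (combine j p)
                        (trans (cong (λ t → combine (proj₁ t) (combine (proj₁ (proj₂ t)) (proj₁ (majority (proj₁ t) x)))) (≡-sym et)) e)
      with ej , ep ← Fin.combine-injective j′ (proj₁ (majority i′ x)) j p ejp =
      subst₂ (λ a b → toℕ a < toℕ b) ei ej i′<j′ ,
      subst₂ (λ a p → Popular a p x) ei ep (proj₂ (majority i′ x)) ,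
      subst₂ (λ a p → Popular a p x) ej (trans (≡-sym same) ep) (proj₂ (majority j′ x))

  module Typical (i j : Fin r) (p : Fin k) {S : Fin P → Set} (S? : ∀ x → Dec (S x))
    (spec : ∀ {x} → S x → toℕ i < toℕ j × Popular i p x × Popular j p x)
    (dense : P ≤ r * (r * k) * count S?) where

    D m : ℕ
    D = W ^ toℕ i
    -- Chosen so that `fourth B * m` is half of `D * q`, which gives `lines*Qm`.
    m = 16 * (B * B * fourth B) * D

    In? : ∀ s x → Dec (S x × f i s x ≡ p)
    In? s x = S? x ×-dec (f i s x Fin.≟ p)

    a : Fin R → Fin P → ℕ
    a s x = 𝟙 (In? s x)

    total : ℕ
    total = sum (λ s → sum (a s))

    pair : Fin R → Fin P → Fin P → ℕ
    pair s x y = a s x * a s y * 𝟙 (label i s x ≟ label i s y)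

    walks : Fin P → ℕ
    walks x = sum (λ s → sum (pair s x))

    lines*Qm : lines i * (fourth B * m) ≡ P
    lines*Qm = *-cancelˡ-≡ _ _ 2 (begin
      2 * (lines i * (fourth B * m))                               ≡⟨ regroup (lines i) (fourth B) (B * B * fourth B) D ⟩
      lines i * (D * (2 * (16 * (B * B * fourth B) * fourth B)))   ≡⟨ cong (λ e → lines i * (D * (2 * e))) BR≡ ⟨
      lines i * (D * (2 * (B * R)))                                ≡⟨ cong (λ q → lines i * (D * q)) q≡ ⟨
      lines i * (D * q)                                            ≡⟨ lines*size i ⟩
      P + P                                                        ≡⟨ cong (P +_) (+-identityʳ P) ⟨
      2 * P                                                        ∎)
      where
      open ≡-Reasoning
      regroup : ∀ L Q C D → 2 * (L * (Q * (16 * C * D))) ≡ L * (D * (2 * (16 * C * Q)))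
      regroup = solve-∀

    cauchy-schwarz : 2 * m * total ≤ sum walks + R * (lines i * (m * m))
    cauchy-schwarz = begin
      2 * m * total                                                     ≡⟨ *-distribˡ-sum (2 * m) (λ s → sum (a s)) ⟩
      sum (λ s → 2 * m * sum (a s))                                     ≤⟨ sum-mono (λ s → collisions (a s) (label i s) (lines i) (label<lines i s) m) ⟩
      sum (λ s → sum (λ x → sum (pair s x)) + lines i * (m * m))        ≡⟨ ∑-distrib-+ (λ s → sum (λ x → sum (pair s x))) (λ _ → lines i * (m * m)) ⟩
      sum (λ s → sum (λ x → sum (pair s x))) + sum {R} (λ _ → lines i * (m * m)) ≡⟨ cong₂ _+_ (∑-comm (λ s x → sum (pair s x))) (sum-const R (lines i * (m * m))) ⟩
      sum walks + R * (lines i * (m * m))                               ∎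
      where open ≤-Reasoning

    -- Averaging the walks point - line - point over their starting points.
    hub : ∃[ x ] m * R ≤ fourth B * walks x
    hub = average (λ x → fourth B * walks x) (m * R) (0<W^ r)
      (≤-trans (walks-dense {P} {R} {fourth B} {m} {lines i} {total}
                 (incidences-dense {R = R} {k = k} {S = count S?} r≤B k≤B dense
                   (double-count S? (λ s x → f i s x Fin.≟ p) k (λ x z → proj₁ (proj₂ (spec z)))))
                 lines*Qm cauchy-schwarz)
               (≤-reflexive (*-distribˡ-sum (fourth B) walks)))

    module Hub (x : Fin P) (large : m * R ≤ fourth B * walks x) where

      Link : Fin R → Fin P → Set
      Link s y = f i s x ≡ p × f i s y ≡ p × label i s x ≡ label i s y

      link? : ∀ s y → Dec (Link s y)
      link? s y = (f i s x Fin.≟ p) ×-dec ((f i s y Fin.≟ p) ×-dec (label i s x ≟ label i s y))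

      Reached : Fin P → Set
      Reached y = S y × Linked i p x y

      reached? : ∀ y → Dec (Reached y)
      reached? y = S? y ×-dec Fin.any? (λ s → link? s y)

      same? : ∀ (y : Fin P) → Dec (shift (toℕ i) (toℕ x) ≡ shift (toℕ i) (toℕ y))
      same? y = shift (toℕ i) (toℕ x) ≟ shift (toℕ i) (toℕ y)

      pair≤ : ∀ s y → pair s x y ≤ 𝟙 (S? y ×-dec link? s y)
      pair≤ s y = ≤-trans
        (≤-reflexive (trans (cong (_* 𝟙 (label i s x ≟ label i s y)) (𝟙-× (In? s x) (In? s y))) (𝟙-× (In? s x ×-dec In? s y) (label i s x ≟ label i s y))))
        (𝟙-mono ((In? s x ×-dec In? s y) ×-dec (label i s x ≟ label i s y)) (S? y ×-dec link? s y)
          (λ (((_ , ex) , (z , ey)) , l) → z , ex , ey , l))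

      -- Outside the block of `x`, two lines of distinct slopes through `x` cannot both contain `y`.
      -- Inside the block all `R` slopes may count, and `same≤` bounds the number of such `y`.
      walks-to≤ : ∀ (y : Fin P) (d : Dec (shift (toℕ i) (toℕ x) ≡ shift (toℕ i) (toℕ y))) →
        sum (λ s → pair s x y) ≤ 𝟙 (reached? y) + 𝟙 d * R
      walks-to≤ y (yes _) = begin
        sum (λ s → pair s x y)     ≤⟨ sum-mono {g = λ _ → 1} (λ s → ≤-trans (pair≤ s y) (𝟙≤ (S? y ×-dec link? s y) (λ _ → ≤-refl))) ⟩
        sum {R} (λ _ → 1)          ≡⟨ trans (sum-const R 1) (*-comm R 1) ⟩
        1 * R                      ≤⟨ m≤n+m (1 * R) (𝟙 (reached? y)) ⟩
        𝟙 (reached? y) + 1 * R     ∎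
        where open ≤-Reasoning
      walks-to≤ y (no differ) = begin
        sum (λ s → pair s x y)               ≤⟨ sum-mono (λ s → pair≤ s y) ⟩
        count (λ s → S? y ×-dec link? s y)   ≤⟨ unique-count≤ (λ s → S? y ×-dec link? s y) (reached? y) unique (λ {s} (z , l) → z , s , l) ⟩
        𝟙 (reached? y)                       ≤⟨ m≤m+n (𝟙 (reached? y)) (0 * R) ⟩
        𝟙 (reached? y) + 0 * R               ∎
        where
        open ≤-Reasoning
        unique : ∀ {s s′} → S y × Link s y → S y × Link s′ y → s ≡ s′
        unique {s} {s′} (_ , _ , _ , l) (_ , _ , _ , l′) = decidable-stable (s Fin.≟ s′) λ s≢s′ →
          differ (two-lines-injective (Fin.toℕ<n s) (Fin.toℕ<n s′) (s≢s′ ∘ Fin.toℕ-injective) l l′)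

      same≤ : count same? ≤ D
      same≤ = count-injective≤ same? (λ y → _%_ (toℕ y) D {{W^≢0 (toℕ i)}}) (λ {y} _ → m%n<n (toℕ y) D {{W^≢0 (toℕ i)}})
        (λ e e′ el → Fin.toℕ-injective (divmod-injective D {{W^≢0 (toℕ i)}} el (trans (≡-sym e) e′)))

      walks≤ : walks x ≤ count reached? + D * R
      walks≤ = begin
        walks x                                                ≡⟨ ∑-comm (λ s y → pair s x y) ⟩
        sum (λ y → sum (λ s → pair s x y))                     ≤⟨ sum-mono (λ y → walks-to≤ y (same? y)) ⟩
        sum (λ y → 𝟙 (reached? y) + 𝟙 (same? y) * R)           ≡⟨ ∑-distrib-+ (λ y → 𝟙 (reached? y)) (λ y → 𝟙 (same? y) * R) ⟩
        count reached? + sum (λ y → 𝟙 (same? y) * R)           ≡⟨ cong (count reached? +_) (*-distribʳ-sum {P} R (λ y → 𝟙 (same? y))) ⟨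
        count reached? + count same? * R                       ≤⟨ +-monoʳ-≤ (count reached?) (*-monoˡ-≤ R same≤) ⟩
        count reached? + D * R                                 ∎
        where open ≤-Reasoning

      star? : ∀ s y → Dec (Reached y × f j s y ≡ p)
      star? s y = reached? y ×-dec (f j s y Fin.≟ p)

      -- Reached points are typical, so `p` is popular for them on level `j` too; averaging over the
      -- slopes fixes one centre.
      big-star : ∃[ s ] count reached? ≤ k * count (star? s)
      big-star = average (λ s → k * count (star? s)) (count reached?) 0<R
        (≤-trans (double-count reached? (λ s y → f j s y Fin.≟ p) k (λ y (z , _) → proj₂ (proj₂ (spec z))))
                 (≤-reflexive (*-distribˡ-sum k (λ s → count (star? s)))))

      -- By `label-later`, all reached points share the level `j` line of slope `s` through `x`, so
      -- the single centre `centre j s x` plays the role of `w`.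
      star≤ : ∀ s → count (star? s) ≤ suc (radius i + radius i)
      star≤ s = linked-neighbours≤ i p x (centre j s x) (star? s)
        (λ {y} ((z , l) , e) → edge-sym {u = inj₁ y} {centre j s x} (edge′ (label-later {i} {j} {proj₁ l} {s} (proj₁ (spec z)) (proj₂ (proj₂ (proj₂ l)))) e) , l)

      absurd : ⊥
      absurd = parameters-clash {B} {R} {D} {q} {r} {k} {count reached?} {count (star? (proj₁ big-star))}
        (≤-trans (≤-<-trans z≤n k<r) r≤B) 0<R (0<W^ (toℕ i)) r≤B k≤B q≡
        (≤-trans large (*-monoʳ-≤ (fourth B) walks≤)) (proj₂ big-star) (star≤ (proj₁ big-star))

    absurd : ⊥
    absurd = Hub.absurd (proj₁ hub) (proj₂ hub)

  refutation : ⊥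
  refutation with c , dense ← popular-value type (0<W^ r) =
    let (i , jp) = remQuot (r * k) c
        (j , p)  = remQuot k jp
    in Typical.absurd i j p (λ x → type x Fin.≟ c)
         (λ e → type-spec i j p (trans e (trans (≡-sym (Fin.combine-remQuot {r} (r * k) c)) (cong (combine i) (≡-sym (Fin.combine-remQuot {r} k jp))))))
         dense

-- Choice of parameters as powers of two

record _≡2^_ (x e : ℕ) : Set where
  constructor pow
  field equation : x ≡ 2 ^ e
open _≡2^_

_⊗_ : ∀ {x y m n} → x ≡2^ m → y ≡2^ n → (x * y) ≡2^ (m + n)
_⊗_ {m = m} {n} (pow refl) (pow refl) = pow (≡-sym (^-distribˡ-+-* 2 m n))

module Host (b r : ℕ) where

  B R q : ℕ
  B = 2 ^ b
  -- The solution of the equation `BR≡` required by `Refutation`.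
  R = 16 * (B * fourth B) * fourth B
  q = 2 * (B * R)

  B-pow : B ≡2^ b
  B-pow = pow refl

  fourth-pow : fourth B ≡2^ (b + b + (b + b))
  fourth-pow = (B-pow ⊗ B-pow) ⊗ (B-pow ⊗ B-pow)

  e : ℕ
  e = 4 + (b + (b + b + (b + b))) + (b + b + (b + b))

  R-pow : R ≡2^ e
  R-pow = (pow {16} {4} refl ⊗ (B-pow ⊗ fourth-pow)) ⊗ fourth-pow

  q-pow : q ≡2^ (1 + (b + e))
  q-pow = pow {2} {1} refl ⊗ (B-pow ⊗ R-pow)

  instance
    R≢0 : NonZero R
    R≢0 = subst NonZero (≡-sym (equation R-pow)) (m^n≢0 2 e)
    q≢0 : NonZero q
    q≢0 = subst NonZero (≡-sym (equation q-pow)) (m^n≢0 2 (1 + (b + e)))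

  open Incidence q R using (W)
  open Construction q R r public

  W-pow : W ≡ 2 ^ (14 + 29 * b)
  W-pow = trans (equation ((R-pow ⊗ q-pow) ⊗ q-pow)) (cong (2 ^_) (exponent b))
    where
    exponent : ∀ b → (4 + (b + (b + b + (b + b))) + (b + b + (b + b)) + (1 + (b + (4 + (b + (b + b + (b + b))) + (b + b + (b + b))))))
      + (1 + (b + (4 + (b + (b + b + (b + b))) + (b + b + (b + b))))) ≡ 14 + 29 * b
    exponent = solve-∀

  order : ℕ
  order = P + r * (R * (P + P))

  Fin↔Vertex : Fin order ↔ Vertex
  Fin↔Vertex = ↔-trans Fin.+↔⊎ (↔-refl ⊎-↔ ↔-trans Fin.*↔× (↔-refl ×-↔ Fin.*↔×))

  open Inverse Fin↔Vertex using (to; from; strictlyInverseˡ; strictlyInverseʳ)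

  graph : Graph order
  graph = record
    { adj   = λ u v → adjacent (to u) (to v)
    ; sym   = λ u v → adjacent-sym (to u) (to v)
    ; irref = λ v → adjacent-irrefl (to v)
    }

  thickness≥ : r ≤ B → ∀ k → ThicknessAtMost graph k → r ≤ k
  thickness≥ r≤B k thin = ≮⇒≥ λ k<r → Refutation.refutation q R r B k k<r r≤B refl (expand B (fourth B))
    (restrict graph from
      (λ {v} {w} e → trans (≡-sym (strictlyInverseˡ v)) (trans (cong to e) (strictlyInverseˡ w)))
      (λ v w → cong₂ adjacent (strictlyInverseˡ v) (strictlyInverseˡ w))
      (λ v u _ → to u , strictlyInverseʳ u)
      thin)
    where
    expand : ∀ B Q → B * (16 * (B * Q) * Q) ≡ 16 * (B * B * Q) * Q
    expand = solve-∀

  0<order : 0 < order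
  0<order = <-≤-trans (>-nonZero⁻¹ P {{Incidence.W^≢0 q R r}}) (m≤m+n P _)

  -- The centres cost at most one further factor `W = R * q * q`, because `2 * r * R` is at most
  -- `q`.
  order≤ : r ≤ B → order ≤ 2 ^ ((14 + 29 * b) * suc r)
  order≤ r≤B = begin
    P + r * (R * (P + P))           ≡⟨ regroup P r R ⟩
    (1 + 2 * (r * R)) * P           ≤⟨ *-monoˡ-≤ P (+-mono-≤ (>-nonZero⁻¹ q) (*-monoʳ-≤ 2 (*-monoˡ-≤ R r≤B))) ⟩
    (q + q) * P                     ≤⟨ *-monoˡ-≤ P (≤-trans (≤-reflexive (cong (q +_) (≡-sym (+-identityʳ q)))) (*-monoˡ-≤ q 2≤q)) ⟩
    q * q * P                       ≤⟨ *-monoˡ-≤ P (≤-trans (m≤n*m (q * q) R) (≤-reflexive (≡-sym (*-assoc R q q)))) ⟩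
    W * P                           ≡⟨ cong (_^ suc r) W-pow ⟩
    (2 ^ (14 + 29 * b)) ^ suc r     ≡⟨ ^-*-assoc 2 (14 + 29 * b) (suc r) ⟩
    2 ^ ((14 + 29 * b) * suc r)     ∎
    where
    open ≤-Reasoning
    regroup : ∀ P r R → P + r * (R * (P + P)) ≡ (1 + 2 * (r * R)) * P
    regroup = solve-∀
    2≤q : 2 ≤ q
    2≤q = m≤m*n 2 (B * R) {{m*n≢0 B R {{m^n≢0 2 b}}}}

-- Logarithms and a thick graph of bounded order

2^⌊log₂n⌋≤n : ∀ n → 0 < n → 2 ^ ⌊log₂ n ⌋ ≤ n
2^⌊log₂n⌋≤n n 0<n = go ⌊log₂ n ⌋ n 0<n refl
  where
  open ≤-Reasoning
  go : ∀ l n → 0 < n → ⌊log₂ n ⌋ ≡ l → 2 ^ l ≤ n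
  go zero    n 0<n _ = 0<n
  go (suc l) 1 _ e = contradiction (trans (≡-sym (⌊log₂[2^n]⌋≡n 0)) e) λ ()
  go (suc l) n@(suc (suc _)) _ e = begin
    2 * 2 ^ l              ≤⟨ *-monoʳ-≤ 2 (go l ⌊ n /2⌋ z<s (trans (⌊log₂⌊n/2⌋⌋≡⌊log₂n⌋∸1 n) (cong (_∸ 1) e))) ⟩
    2 * ⌊ n /2⌋            ≡⟨ cong (⌊ n /2⌋ +_) (+-identityʳ ⌊ n /2⌋) ⟩
    ⌊ n /2⌋ + ⌊ n /2⌋      ≤⟨ +-monoʳ-≤ ⌊ n /2⌋ (⌊n/2⌋≤⌈n/2⌉ n) ⟩
    ⌊ n /2⌋ + ⌈ n /2⌉      ≡⟨ ⌊n/2⌋+⌈n/2⌉≡n n ⟩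
    n                      ∎

n<2^[1+⌊log₂n⌋] : ∀ n → n < 2 ^ suc ⌊log₂ n ⌋
n<2^[1+⌊log₂n⌋] n = ≰⇒> λ h → <⇒≱ (n<1+n ⌊log₂ n ⌋)
  (subst (_≤ ⌊log₂ n ⌋) (⌊log₂[2^n]⌋≡n (suc ⌊log₂ n ⌋)) (⌊log₂⌋-mono-≤ h))

0<⌊log₂n⌋ : ∀ {n} → 2 ≤ n → 0 < ⌊log₂ n ⌋
0<⌊log₂n⌋ = ⌊log₂⌋-mono-≤

edgeless : ∀ n → Graph n
edgeless n = record { adj = λ _ _ → false ; sym = λ _ _ → refl ; irref = λ _ → refl }

-- The map `part` is defined on all pairs, adjacent or not, so a single vertex already forces a part
-- to exist.
0<thickness : ∀ {n j} (G : Graph n) → 0 < n → ThicknessAtMost G j → 0 < j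
0<thickness {suc _} G _ (part , _) = ≤-<-trans z≤n (Fin.toℕ<n (part zero zero))

-- The constant is `516 = 3 * 86 * 2`, where the 2 comes from `suc ll ≤ ll + ll`.
rate≤ : ∀ {l ll j t} → 0 < ll → t ≤ 3 * j → l ≤ t * (86 * suc ll) → l ≤ 516 * j * ll
rate≤ {l} {ll} {j} {t} 0<ll t≤ l≤ = begin
  l                              ≤⟨ l≤ ⟩
  t * (86 * suc ll)              ≤⟨ *-mono-≤ t≤ (*-monoʳ-≤ 86 (+-monoˡ-≤ ll 0<ll)) ⟩
  3 * j * (86 * (ll + ll))       ≡⟨ regroup j ll ⟩
  516 * j * ll                   ∎
  where
  open ≤-Reasoning
  regroup : ∀ j ll → 3 * j * (86 * (ll + ll)) ≡ 516 * j * ll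
  regroup = solve-∀

-- Bounding the square of the order lets the same graph serve both claims, since it bounds the
-- number of vertices and the number of edges.
thick-graph : ∀ l → 2 ≤ l → ∃[ n ] Σ (Graph n) λ G →
  0 < n × n * n ≤ 2 ^ l × ThicknessLowerBound G 516 l ⌊log₂ l ⌋
thick-graph l 2≤l = build (l / (86 * b)) refl
  where
  b : ℕ
  b = suc ⌊log₂ l ⌋
  l≤ : l ≤ suc (l / (86 * b)) * (86 * b)
  l≤ = ≤-trans (≤-reflexive (m≡m%n+[m/n]*n l (86 * b))) (+-monoˡ-≤ (l / (86 * b) * (86 * b)) (m%n≤n l (86 * b)))
  build : ∀ t → l / (86 * b) ≡ t → ∃[ n ] Σ (Graph n) λ G →
    0 < n × n * n ≤ 2 ^ l × ThicknessLowerBound G 516 l ⌊log₂ l ⌋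
  -- Here `l` is at most `86 * b`, so thickness at least one suffices.
  build zero e = 1 , edgeless 1 , z<s , >-nonZero⁻¹ (2 ^ l) {{m^n≢0 2 l}} , λ j thin →
    rate≤ {j = j} {1} (0<⌊log₂n⌋ 2≤l) (≤-trans (0<thickness (edgeless 1) z<s thin) (m≤n*m j 3)) (subst (λ t → l ≤ suc t * (86 * b)) e l≤)
  build (suc r) e = order , graph , 0<order , square , λ j thin →
    rate≤ {j = j} {2 + r} (0<⌊log₂n⌋ 2≤l)
      -- From `1 ≤ j` twice and `r ≤ j` follows `2 + r ≤ 3 * j`, which absorbs the rounding of the
      -- quotient.
      (+-mono-≤ (0<thickness graph 0<order thin) (≤-trans (+-mono-≤ (0<thickness graph 0<order thin) (thickness≥ r≤B j thin)) (≤-reflexive (cong (j +_) (≡-sym (+-identityʳ j))))))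
      (subst (λ t → l ≤ suc t * (86 * b)) e l≤)
    where
    open Host b r using (B; order; graph; 0<order; order≤; thickness≥)
    r≤B : r ≤ B
    r≤B = <⇒≤ (<-≤-trans (subst (r <_) (≡-sym e) (n<1+n r)) (≤-trans (m/n≤m l (86 * b)) (<⇒≤ (n<2^[1+⌊log₂n⌋] l))))
    exponent≤ : (14 + 29 * b) * suc r + (14 + 29 * b) * suc r ≤ l
    exponent≤ = begin
      -- Since `b` is positive, `14 + 29 * b` is at most `43 * b`; squaring the order doubles this
      -- to the divisor `86 * b`.
      (14 + 29 * b) * suc r + (14 + 29 * b) * suc r   ≤⟨ +-mono-≤ half half ⟩
      43 * b * suc r + 43 * b * suc r                 ≡⟨ regroup b (suc r) ⟩
      suc r * (86 * b)                                ≡⟨ cong (_* (86 * b)) e ⟨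
      l / (86 * b) * (86 * b)                         ≤⟨ m/n*n≤m l (86 * b) ⟩
      l                                               ∎
      where
      open ≤-Reasoning
      regroup : ∀ b r → 43 * b * r + 43 * b * r ≡ r * (86 * b)
      regroup = solve-∀
      half : (14 + 29 * b) * suc r ≤ 43 * b * suc r
      half = *-monoˡ-≤ (suc r) (≤-trans (+-monoˡ-≤ (29 * b) (m≤m*n 14 b)) (≤-reflexive (≡-sym (*-distribʳ-+ b 14 29))))
    square : order * order ≤ 2 ^ l
    square = ≤-trans (*-mono-≤ (order≤ r≤B) (order≤ r≤B))
      (≤-trans (≤-reflexive (≡-sym (^-distribˡ-+-* 2 ((14 + 29 * b) * suc r) ((14 + 29 * b) * suc r)))) (^-monoʳ-≤ 2 exponent≤))

-- Padding to a prescribed number of vertices or edges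

addVertex : ∀ {n} → Graph n → Graph (suc n)
addVertex {n} G = record { adj = adj′ ; sym = sym′ ; irref = irref′ }
  where
  adj′ : Fin (suc n) → Fin (suc n) → Bool
  adj′ (suc u) (suc v) = adj G u v
  adj′ _       _       = false
  sym′ : ∀ u v → adj′ u v ≡ adj′ v u
  sym′ zero    zero    = refl
  sym′ zero    (suc _) = refl
  sym′ (suc _) zero    = refl
  sym′ (suc u) (suc v) = sym G u v
  irref′ : ∀ v → adj′ v v ≡ false
  irref′ zero    = refl
  irref′ (suc v) = irref G v

addEdge : ∀ {n} → Graph n → Graph (2 + n)
addEdge {n} G = record { adj = adj′ ; sym = sym′ ; irref = irref′ }
  where
  adj′ : Fin (2 + n) → Fin (2 + n) → Bool
  adj′ zero          (suc zero)    = true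
  adj′ (suc zero)    zero          = true
  adj′ (suc (suc u)) (suc (suc v)) = adj G u v
  adj′ _             _             = false
  sym′ : ∀ u v → adj′ u v ≡ adj′ v u
  sym′ zero          zero          = refl
  sym′ zero          (suc zero)    = refl
  sym′ zero          (suc (suc _)) = refl
  sym′ (suc zero)    zero          = refl
  sym′ (suc zero)    (suc zero)    = refl
  sym′ (suc zero)    (suc (suc _)) = refl
  sym′ (suc (suc _)) zero          = refl
  sym′ (suc (suc _)) (suc zero)    = refl
  sym′ (suc (suc u)) (suc (suc v)) = sym G u v
  irref′ : ∀ v → adj′ v v ≡ false
  irref′ zero          = refl
  irref′ (suc zero)    = refl
  irref′ (suc (suc v)) = irref G v

module _ {n a L LL} (G : Graph n) (bound : ThicknessLowerBound G a L LL) where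

  -- The old vertices are a union of components of the padded graph, so every decomposition of it
  -- restricts to them.
  addVertex-bound : ThicknessLowerBound (addVertex G) a L LL
  addVertex-bound j thin = bound j (restrict (addVertex G) suc Fin.suc-injective (λ _ _ → refl)
    (λ { _ zero () ; _ (suc w) _ → w , refl }) thin)

  addEdge-bound : ThicknessLowerBound (addEdge G) a L LL
  addEdge-bound j thin = bound j (restrict (addEdge G) (λ v → suc (suc v)) (Fin.suc-injective ∘ Fin.suc-injective) (λ _ _ → refl)
    (λ { _ zero () ; _ (suc zero) () ; _ (suc (suc w)) _ → w , refl }) thin)

sum-allFin : ∀ {n} (g : Fin n → ℕ) → List.sum (map g (allFin n)) ≡ sum g
sum-allFin g = trans (cong List.sum (map-tabulate id g)) (sum-tabulate g)
  where
  sum-tabulate : ∀ {n} (g : Fin n → ℕ) → List.sum (tabulate g) ≡ sum g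
  sum-tabulate {zero}  g = refl
  sum-tabulate {suc n} g = cong (g zero +_) (sum-tabulate (g ∘ suc))

edge-indicator : ∀ {n} → Graph n → Fin n → Fin n → ℕ
edge-indicator G u w = if adj G u w ∧ (toℕ u <ᵇ toℕ w) then 1 else 0

edgeCount≡ : ∀ {n} (G : Graph n) → edgeCount G ≡ sum (λ u → sum (edge-indicator G u))
edgeCount≡ {n} G = trans (sum-allFin (λ u → List.sum (map (edge-indicator G u) (allFin n)))) (sum-cong-≗ {n} (λ u → sum-allFin (edge-indicator G u)))

edgeCount≤ : ∀ {n} (G : Graph n) → edgeCount G ≤ n * n
edgeCount≤ {n} G = begin
  edgeCount G                                ≡⟨ edgeCount≡ G ⟩
  sum (λ u → sum (edge-indicator G u))       ≤⟨ sum-mono (λ u → sum-mono (λ w → indicator≤1 (adj G u w ∧ (toℕ u <ᵇ toℕ w)))) ⟩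
  sum {n} (λ _ → sum {n} (λ _ → 1))          ≡⟨ sum-const n (sum {n} (λ _ → 1)) ⟩
  n * sum {n} (λ _ → 1)                      ≡⟨ cong (n *_) (trans (sum-const n 1) (*-identityʳ n)) ⟩
  n * n                                      ∎
  where
  open ≤-Reasoning
  indicator≤1 : ∀ c → (if c then 1 else 0) ≤ 1
  indicator≤1 true  = ≤-refl
  indicator≤1 false = z≤n

addEdge-edgeCount : ∀ {n} (G : Graph n) → edgeCount (addEdge G) ≡ suc (edgeCount G)
addEdge-edgeCount {n} G = begin
  edgeCount (addEdge G)                                              ≡⟨ edgeCount≡ (addEdge G) ⟩
  -- The new edge is counted only in row zero, since the order test rejects its reverse; the
  -- remaining rows are those of `G`.
  suc (sum {n} (λ _ → 0)) + (sum {n} (λ _ → 0) + sum (λ u → sum (edge-indicator G u))) ≡⟨ cong (λ z → suc z + (z + sum (λ u → sum (edge-indicator G u)))) (trans (sum-const n 0) (*-zeroʳ n)) ⟩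
  suc (sum (λ u → sum (edge-indicator G u)))                         ≡⟨ cong suc (edgeCount≡ G) ⟨
  suc (edgeCount G)                                                  ∎
  where open ≡-Reasoning

module _ {n₀ a L LL} (G₀ : Graph n₀) (bound : ThicknessLowerBound G₀ a L LL) where

  pad-vertices : ∀ d → ∃[ G ] ThicknessLowerBound {d + n₀} G a L LL
  pad-vertices zero    = G₀ , bound
  pad-vertices (suc d) = let (G , h) = pad-vertices d in addVertex G , addVertex-bound {a = a} G h

  pad-edges : ∀ d → ∃[ n ] Σ (Graph n) λ G → edgeCount G ≡ d + edgeCount G₀ × ThicknessLowerBound G a L LL
  pad-edges zero    = n₀ , G₀ , refl , bound
  pad-edges (suc d) = let (n , G , e , h) = pad-edges d in
    2 + n , addEdge G , trans (addEdge-edgeCount G) (cong suc e) , addEdge-bound {a = a} G h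

theorem2 : (∃[ a ] ∃[ N ] ∀ n → N ≤ n →
    ∃[ G ] ThicknessLowerBound {n} G a ⌊log₂ n ⌋ ⌊log₂ ⌊log₂ n ⌋ ⌋)
    × (∃[ a ] ∃[ M ] ∀ m → M ≤ m →
    ∃[ n ] Σ (Graph n) λ G → edgeCount G ≡ m
    × ThicknessLowerBound G a ⌊log₂ m ⌋ ⌊log₂ ⌊log₂ m ⌋ ⌋)
-- From 4 on the logarithm is at least 2, so the iterated logarithm is positive.
theorem2 = (516 , 4 , on-vertices) , (516 , 4 , on-edges)
  where
  square≤ : ∀ {n₀ n} → 4 ≤ n → n₀ * n₀ ≤ 2 ^ ⌊log₂ n ⌋ → n₀ * n₀ ≤ n
  square≤ {n = n} 4≤n h = ≤-trans h (2^⌊log₂n⌋≤n n (≤-trans (s≤s z≤n) 4≤n))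
  on-vertices : ∀ n → 4 ≤ n → ∃[ G ] ThicknessLowerBound {n} G 516 ⌊log₂ n ⌋ ⌊log₂ ⌊log₂ n ⌋ ⌋
  on-vertices n 4≤n =
    let (n₀ , G₀ , 0<n₀ , sq , bound) = thick-graph ⌊log₂ n ⌋ (⌊log₂⌋-mono-≤ 4≤n)
        n₀≤n = ≤-trans (m≤m*n n₀ n₀ {{>-nonZero 0<n₀}}) (square≤ {n₀} 4≤n sq)
    in subst (λ n′ → ∃[ G ] ThicknessLowerBound {n′} G 516 ⌊log₂ n ⌋ ⌊log₂ ⌊log₂ n ⌋ ⌋) (m∸n+n≡m n₀≤n)
         (pad-vertices {a = 516} G₀ bound (n ∸ n₀))
  on-edges : ∀ m → 4 ≤ m → ∃[ n ] Σ (Graph n) λ G → edgeCount G ≡ m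
    × ThicknessLowerBound G 516 ⌊log₂ m ⌋ ⌊log₂ ⌊log₂ m ⌋ ⌋
  on-edges m 4≤m =
    let (n₀ , G₀ , _ , sq , bound) = thick-graph ⌊log₂ m ⌋ (⌊log₂⌋-mono-≤ 4≤m)
        (n , G , e , h) = pad-edges {a = 516} G₀ bound (m ∸ edgeCount G₀)
    in n , G , trans e (m∸n+n≡m (≤-trans (edgeCount≤ G₀) (square≤ {n₀} 4≤m sq))) , h
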